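{- There exists a family of unsatisfiable CNF formulas $\{F_n\}$, where $F_n$ has $n$ variables, such that every Stabbing Planes refutation of $F_n$ has depth $\Omega(n/\log^2 n)$.
   Context: Encoding of CNFs: a CNF formula is translated to a system of linear inequalities by including $0\le x_i\le 1$ for every variable $x_i$, and for every clause $\bigvee_{i\in I}x_i\vee\bigvee_{j\in J}\neg x_j$ the inequality $\sum_{i\in I}x_i+\sum_{j\in J}(1-x_j)\ge 1$. A Stabbing Planes refutation of a CNF is a refutation of this system. Stabbing Planes (SP): let $Ax\ge b$ be a system of integer linear inequalities in real variables with no integer solution. An SP refutation of it is a directed binary tree whose edges are labelled by integer linear inequalities such that: (internal nodes) if the right outgoing edge of an internal node is labelled $cx\ge d$ ($c$ an integer vector, $d$ an integer), then its left outgoing edge is labelled $cx\le d-1$; (leaves) each leaf is labelled with a conic (nonnegative) combination of inequalities of $Ax\ge b$ and of inequalities labelling the path from the root to that leaf which yields $0\ge 1$. The depth is the length of the longest root-to-leaf path.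
   Formalization: The nonnegative multipliers in the conic combinations at the leaves of a Stabbing Planes refutation are taken to be rational rather than real. -}

module Defs where

open import Algebra.Properties.Monoid.Sum using (sum)
open import Data.Bool.Base using (Bool; true; false; if_then_else_)
open import Data.Fin.Base using (Fin)
open import Data.Fin.Subset using (Subset; _∈_; ⁅_⁆; ∣_∣)
open import Data.Integer.Base as ℤ using (ℤ; +_; 0ℤ; 1ℤ)
open import Data.List.Base using (List; _∷_; _++_; map; allFin; length; lookup)
open import Data.List.Relation.Unary.All using (All)
open import Data.Nat.Base as ℕ using (ℕ)
open import Data.Product.Base using (∃; _×_)
open import Data.Rational.Base as ℚ using (ℚ; 0ℚ; 1ℚ)
open import Data.Rational.Properties using (+-0-monoid)
open import Data.Sum.Base using (_⊎_)
import Data.Vec.Base as Vec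
open import Relation.Binary.PropositionalEquality using (_≡_)
open import Relation.Nullary using (¬_)

-- The clause ⋁_{i ∈ pos} xᵢ ∨ ⋁_{j ∈ neg} ¬ xⱼ.
record Clause (n : ℕ) : Set where
  constructor clause
  field
    pos neg : Subset n

CNF : ℕ → Set
CNF n = List (Clause n)

Assignment : ℕ → Set
Assignment n = Fin n → Bool

SatisfiesClause : ∀ {n} → Assignment n → Clause n → Set
SatisfiesClause α C =
  ∃ λ i → (i ∈ Clause.pos C × α i ≡ true) ⊎ (i ∈ Clause.neg C × α i ≡ false)

Satisfies : ∀ {n} → Assignment n → CNF n → Set
Satisfies α F = All (SatisfiesClause α) F

Unsatisfiable : ∀ {n} → CNF n → Set
Unsatisfiable F = ∀ α → ¬ Satisfies α F

-- The integer linear inequality Σᵢ coeff i · xᵢ ≥ bound.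
record Ineq (n : ℕ) : Set where
  constructor ineq
  field
    coeff : Fin n → ℤ
    bound : ℤ

open Ineq

System : ℕ → Set
System n = List (Ineq n)

geq : ∀ {n} → (Fin n → ℤ) → ℤ → Ineq n
geq c d = ineq c d

-- c x ≤ d, stored as (- c) x ≥ - d.
leq : ∀ {n} → (Fin n → ℤ) → ℤ → Ineq n
leq c d = ineq (λ i → ℤ.- c i) (ℤ.- d)

χ : ∀ {n} → Subset n → Fin n → ℤ
χ I i = if Vec.lookup I i then 1ℤ else 0ℤ

-- Σ_{i ∈ I} xᵢ + Σ_{j ∈ J} (1 - xⱼ) ≥ 1, with the constant |J| moved to the
-- right-hand side.
clauseIneq : ∀ {n} → Clause n → Ineq n
clauseIneq (clause I J) = geq (λ i → χ I i ℤ.- χ J i) (1ℤ ℤ.- + ∣ J ∣)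

encode : ∀ {n} → CNF n → System n
encode {n} F =
     map (λ i → geq (χ ⁅ i ⁆) 0ℤ) (allFin n)
  ++ map (λ i → leq (χ ⁅ i ⁆) 1ℤ) (allFin n)
  ++ map clauseIneq F

ℤ→ℚ : ℤ → ℚ
ℤ→ℚ z = z ℚ./ 1

-- A conic combination of the inequalities of S that is literally 0 ≥ 1.
-- Rational multipliers suffice: for integer data, a real combination exists
-- iff a rational one does.
record ConicContradiction {n} (S : System n) : Set where
  field
    multiplier  : Fin (length S) → ℚ
    nonNegative : ∀ k → 0ℚ ℚ.≤ multiplier k
    coeffs-zero : ∀ i →
      sum +-0-monoid (λ k → multiplier k ℚ.* ℤ→ℚ (coeff (lookup S k) i)) ≡ 0ℚ
    bound-one   :
      sum +-0-monoid (λ k → multiplier k ℚ.* ℤ→ℚ (bound (lookup S k))) ≡ 1ℚ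

-- In a subtree, the index S is the original system extended by the labels on
-- the path from the root; leaves may thus use both.
data Refutation {n} (S : System n) : Set where
  leaf : ConicContradiction S → Refutation S
  node : (c : Fin n → ℤ) (d : ℤ) →
         (left  : Refutation (leq c (d ℤ.- 1ℤ) ∷ S)) →
         (right : Refutation (geq c d ∷ S)) →
         Refutation S

depth : ∀ {n} {S : System n} → Refutation S → ℕ
depth (leaf _)       = 0
depth (node _ _ l r) = ℕ.suc (depth l ℕ.⊔ depth r)

SPRefutation : ∀ {n} → CNF n → Set
SPRefutation F = Refutation (encode F)

{-# OPTIONS --safe #-}
-- Take for F n all 2ⁿ clauses of width n; the clause falsified exactly by u
-- says that x has ℓ₁-distance at least 1 from u.  If two 0/1 points differ in
-- at least two coordinates, then their midpoint has distance at least 1 from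
-- every 0/1 point, so it satisfies the whole encoding.  Hence no leaf of a
-- refutation is reached by both of them.  A set of 2^⌊n/2⌋ points with pairwise
-- distances at least 2 therefore forces 2^⌊n/2⌋ leaves, hence depth ⌊n/2⌋.
module Submission where

open import Defs
open import Algebra.Bundles using (CommutativeRing)
import Algebra.Properties.Semiring.Sum as SemiringSum
open import Data.Bool.Base using (true; false)
open import Data.Fin.Base using (Fin; zero; suc)
open import Data.Fin.Subset using (Subset; inside; outside; _∈_; ⁅_⁆; ∣_∣; ∁; _∩_)
open import Data.Fin.Subset.Properties using (∣⁅x⁆∣≡1; ∣p∩q∣≤∣p∣; x∈∁p⇒x∉p)
open import Data.Integer.Base as ℤ using (ℤ; +_; 0ℤ; 1ℤ)
import Data.Integer.Properties as ℤ
open import Data.Integer.Tactic.RingSolver using (solve-∀)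
open import Data.List.Base using (List; []; _∷_; [_]; _++_; map; allFin; filter; length; lookup)
open import Data.List.Membership.Propositional using () renaming (_∈_ to _∈ₗ_)
open import Data.List.Membership.Propositional.Properties using (∈-map⁺; ∈-++⁺ˡ; ∈-++⁺ʳ; ∈-lookup)
open import Data.List.Properties using (length-++; length-map)
open import Data.List.Relation.Unary.All as All using (All; []; _∷_)
import Data.List.Relation.Unary.All.Properties as All
open import Data.List.Relation.Unary.AllPairs as AllPairs using (AllPairs; []; _∷_)
import Data.List.Relation.Unary.AllPairs.Properties as AllPairs
open import Data.List.Relation.Unary.Any using (here)
open import Data.Nat.Base using (ℕ; zero; suc; s≤s; z≤n; _≤_; _+_; _*_; _^_; _⊔_; ⌊_/2⌋)
open import Data.Nat.Logarithm using (⌊log₂_⌋; ⌊log₂⌋-mono-≤)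
import Data.Nat.Properties as ℕ
open import Data.Product.Base using (Σ-syntax; ∃-syntax; _×_; _,_)
open import Data.Rational.Base as ℚ using (ℚ; 0ℚ; 1ℚ)
import Data.Rational.Properties as ℚ
open import Data.Rational.Unnormalised.Base as ℚᵘ using (mkℚᵘ; *≡*; *≤*)
import Data.Rational.Unnormalised.Properties as ℚᵘ
open import Data.Sum.Base using (inj₁; inj₂)
open import Data.Vec.Base as Vec using ([]; _∷_)
open import Data.Vec.Properties using (lookup∘tabulate; lookup⇒[]=; []=⇒lookup)
open import Function.Base using (_∘_)
open import Relation.Binary.PropositionalEquality
  using (_≡_; refl; sym; trans; cong; cong₂; subst; subst₂; module ≡-Reasoning)
open import Relation.Nullary using (¬_; contradiction; does)
open import Relation.Nullary.Decidable using (¬?)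
open import Relation.Unary using (Decidable)

module ℤΣ = SemiringSum ℤ.+-*-semiring
module ℚΣ = SemiringSum (CommutativeRing.semiring ℚ.+-*-commutativeRing)

private
  variable
    n : ℕ

-- The embedding of the integers into the rationals

-- `z ℚ./ 1` is stored in normalised form. This equivalence moves the homomorphism laws to
-- unnormalised rationals, where they reduce to integer identities.
toℚᵘ-ℤ→ℚ : ∀ z → ℚ.toℚᵘ (ℤ→ℚ z) ℚᵘ.≃ mkℚᵘ z 0
toℚᵘ-ℤ→ℚ z = ℚ.toℚᵘ-fromℚᵘ (mkℚᵘ z 0)

ℤ→ℚ-homo-+ : ∀ a b → ℤ→ℚ (a ℤ.+ b) ≡ ℤ→ℚ a ℚ.+ ℤ→ℚ b
ℤ→ℚ-homo-+ a b = ℚ.toℚᵘ-injective (begin-equality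
  ℚ.toℚᵘ (ℤ→ℚ (a ℤ.+ b))                ≃⟨ toℚᵘ-ℤ→ℚ (a ℤ.+ b) ⟩
  mkℚᵘ (a ℤ.+ b) 0                      ≃⟨ *≡* (cong (ℤ._* 1ℤ) (sym (cong₂ ℤ._+_ (ℤ.*-identityʳ a) (ℤ.*-identityʳ b)))) ⟩
  mkℚᵘ a 0 ℚᵘ.+ mkℚᵘ b 0                ≃⟨ ℚᵘ.+-cong (toℚᵘ-ℤ→ℚ a) (toℚᵘ-ℤ→ℚ b) ⟨
  ℚ.toℚᵘ (ℤ→ℚ a) ℚᵘ.+ ℚ.toℚᵘ (ℤ→ℚ b)    ≃⟨ ℚ.toℚᵘ-homo-+ (ℤ→ℚ a) (ℤ→ℚ b) ⟨
  ℚ.toℚᵘ (ℤ→ℚ a ℚ.+ ℤ→ℚ b)              ∎)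
  where open ℚᵘ.≤-Reasoning

ℤ→ℚ-homo-* : ∀ a b → ℤ→ℚ (a ℤ.* b) ≡ ℤ→ℚ a ℚ.* ℤ→ℚ b
ℤ→ℚ-homo-* a b = ℚ.toℚᵘ-injective (begin-equality
  ℚ.toℚᵘ (ℤ→ℚ (a ℤ.* b))                ≃⟨ toℚᵘ-ℤ→ℚ (a ℤ.* b) ⟩
  mkℚᵘ a 0 ℚᵘ.* mkℚᵘ b 0                ≃⟨ ℚᵘ.*-cong (toℚᵘ-ℤ→ℚ a) (toℚᵘ-ℤ→ℚ b) ⟨
  ℚ.toℚᵘ (ℤ→ℚ a) ℚᵘ.* ℚ.toℚᵘ (ℤ→ℚ b)    ≃⟨ ℚ.toℚᵘ-homo-* (ℤ→ℚ a) (ℤ→ℚ b) ⟨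
  ℚ.toℚᵘ (ℤ→ℚ a ℚ.* ℤ→ℚ b)              ∎)
  where open ℚᵘ.≤-Reasoning

ℤ→ℚ-mono-≤ : ∀ {a b} → a ℤ.≤ b → ℤ→ℚ a ℚ.≤ ℤ→ℚ b
ℤ→ℚ-mono-≤ {a} {b} a≤b = ℚ.toℚᵘ-cancel-≤ (begin
  ℚ.toℚᵘ (ℤ→ℚ a)  ≃⟨ toℚᵘ-ℤ→ℚ a ⟩
  mkℚᵘ a 0        ≤⟨ *≤* (ℤ.*-monoʳ-≤-nonNeg 1ℤ a≤b) ⟩
  mkℚᵘ b 0        ≃⟨ toℚᵘ-ℤ→ℚ b ⟨
  ℚ.toℚᵘ (ℤ→ℚ b)  ∎)
  where open ℚᵘ.≤-Reasoning

ℤ→ℚ-homo-sum : (f : Fin n → ℤ) → ℤ→ℚ (ℤΣ.sum f) ≡ ℚΣ.sum (ℤ→ℚ ∘ f)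
ℤ→ℚ-homo-sum {zero}  f = refl
ℤ→ℚ-homo-sum {suc n} f =
  trans (ℤ→ℚ-homo-+ (f zero) _) (cong (ℤ→ℚ (f zero) ℚ.+_) (ℤ→ℚ-homo-sum (f ∘ suc)))

ℚ-sum-mono-≤ : {f g : Fin n → ℚ} → (∀ i → f i ℚ.≤ g i) → ℚΣ.sum f ℚ.≤ ℚΣ.sum g
ℚ-sum-mono-≤ {zero}  f≤g = ℚ.≤-refl
ℚ-sum-mono-≤ {suc n} f≤g = ℚ.+-mono-≤ (f≤g zero) (ℚ-sum-mono-≤ (f≤g ∘ suc))

-- Conic contradictions exclude feasible points

infix 7 _·_
_·_ : (Fin n → ℤ) → (Fin n → ℤ) → ℤ
c · x = ℤΣ.sum (λ i → c i ℤ.* x i)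

-- The rational point p / q satisfies the inequality, for q > 0.
Satisfied : (p : Fin n → ℤ) (q : ℤ) → Ineq n → Set
Satisfied p q (ineq c d) = q ℤ.* d ℤ.≤ c · p

-- Evaluate the combination at `p / q`, scaled by `q` to keep the inequalities integral. The bounds
-- add up to `q` and the left-hand sides to 0, which gives `q ≤ 0`.
feasible⇒¬contradiction : ∀ {S : System n} (p : Fin n → ℤ) (q : ℤ) → 0ℚ ℚ.< ℤ→ℚ q →
                          All (Satisfied p q) S → ¬ ConicContradiction S
feasible⇒¬contradiction {n} {S} p q 0<q sat contr = ℚ.<-irrefl refl (ℚ.<-≤-trans 0<q (begin
  ℤ→ℚ q                                                 ≡⟨ ℚ.*-identityʳ _ ⟨
  ℤ→ℚ q ℚ.* 1ℚ                                          ≡⟨ cong (ℤ→ℚ q ℚ.*_) bound-one ⟨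
  ℤ→ℚ q ℚ.* ℚΣ.sum (λ k → m k ℚ.* ℤ→ℚ (b k))            ≡⟨ ℚΣ.*-distribˡ-sum (ℤ→ℚ q) (λ k → m k ℚ.* ℤ→ℚ (b k)) ⟩
  ℚΣ.sum (λ k → ℤ→ℚ q ℚ.* (m k ℚ.* ℤ→ℚ (b k)))          ≤⟨ ℚ-sum-mono-≤ weighted ⟩
  ℚΣ.sum (λ k → m k ℚ.* ℤ→ℚ (c k · p))                  ≡⟨ ℚΣ.sum-cong-≗ expand ⟩
  -- Summing over the inequalities first collects the total coefficient of each variable, which is
  -- zero.
  ℚΣ.sum (λ k → ℚΣ.sum (λ i → t k i ℚ.* ℤ→ℚ (p i)))     ≡⟨ ℚΣ.∑-comm (λ k i → t k i ℚ.* ℤ→ℚ (p i)) ⟩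
  ℚΣ.sum (λ i → ℚΣ.sum (λ k → t k i ℚ.* ℤ→ℚ (p i)))     ≡⟨ ℚΣ.sum-cong-≗ vanish ⟩
  ℚΣ.sum {n} (λ _ → 0ℚ)                                 ≡⟨ ℚΣ.sum-replicate-zero n ⟩
  0ℚ                                                    ∎))
  where
  open ConicContradiction contr renaming (multiplier to m)
  open ℚ.≤-Reasoning
  c : Fin (length S) → Fin n → ℤ
  c k = Ineq.coeff (lookup S k)
  b : Fin (length S) → ℤ
  b k = Ineq.bound (lookup S k)
  t : Fin (length S) → Fin n → ℚ
  t k i = m k ℚ.* ℤ→ℚ (c k i)

  weighted : ∀ k → ℤ→ℚ q ℚ.* (m k ℚ.* ℤ→ℚ (b k)) ℚ.≤ m k ℚ.* ℤ→ℚ (c k · p)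
  weighted k = begin
    ℤ→ℚ q ℚ.* (m k ℚ.* ℤ→ℚ (b k))  ≡⟨ ℚ.*-assoc (ℤ→ℚ q) (m k) _ ⟨
    ℤ→ℚ q ℚ.* m k ℚ.* ℤ→ℚ (b k)    ≡⟨ cong (ℚ._* ℤ→ℚ (b k)) (ℚ.*-comm (ℤ→ℚ q) (m k)) ⟩
    m k ℚ.* ℤ→ℚ q ℚ.* ℤ→ℚ (b k)    ≡⟨ ℚ.*-assoc (m k) (ℤ→ℚ q) _ ⟩
    m k ℚ.* (ℤ→ℚ q ℚ.* ℤ→ℚ (b k))  ≡⟨ cong (m k ℚ.*_) (ℤ→ℚ-homo-* q (b k)) ⟨
    m k ℚ.* ℤ→ℚ (q ℤ.* b k)        ≤⟨ ℚ.*-monoˡ-≤-nonNeg (m k) {{ℚ.nonNegative (nonNegative k)}}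
                                        (ℤ→ℚ-mono-≤ (All.lookup sat (∈-lookup k))) ⟩
    m k ℚ.* ℤ→ℚ (c k · p)          ∎

  expand : ∀ k → m k ℚ.* ℤ→ℚ (c k · p) ≡ ℚΣ.sum (λ i → t k i ℚ.* ℤ→ℚ (p i))
  expand k = begin-equality
    m k ℚ.* ℤ→ℚ (c k · p)                              ≡⟨ cong (m k ℚ.*_) (ℤ→ℚ-homo-sum (λ i → c k i ℤ.* p i)) ⟩
    m k ℚ.* ℚΣ.sum (λ i → ℤ→ℚ (c k i ℤ.* p i))         ≡⟨ ℚΣ.*-distribˡ-sum (m k) (λ i → ℤ→ℚ (c k i ℤ.* p i)) ⟩
    ℚΣ.sum (λ i → m k ℚ.* ℤ→ℚ (c k i ℤ.* p i))         ≡⟨ ℚΣ.sum-cong-≗ (λ i →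
      trans (cong (m k ℚ.*_) (ℤ→ℚ-homo-* (c k i) (p i))) (sym (ℚ.*-assoc (m k) _ _))) ⟩
    ℚΣ.sum (λ i → t k i ℚ.* ℤ→ℚ (p i))                 ∎

  vanish : ∀ i → ℚΣ.sum (λ k → t k i ℚ.* ℤ→ℚ (p i)) ≡ 0ℚ
  vanish i = begin-equality
    ℚΣ.sum (λ k → t k i ℚ.* ℤ→ℚ (p i))        ≡⟨ ℚΣ.*-distribʳ-sum (ℤ→ℚ (p i)) (λ k → t k i) ⟨
    ℚΣ.sum (λ k → t k i) ℚ.* ℤ→ℚ (p i)        ≡⟨ cong (ℚ._* ℤ→ℚ (p i)) (coeffs-zero i) ⟩
    0ℚ ℚ.* ℤ→ℚ (p i)                          ≡⟨ ℚ.*-zeroˡ (ℤ→ℚ (p i)) ⟩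
    0ℚ                                        ∎

-- Counting leaves

2ℤ : ℤ
2ℤ = + 2

-- Only the midpoint `(x + y) / 2` has to satisfy the inequality. A 0/1 point by itself always
-- violates one clause of the complete formula.
MidpointSatisfies : (x y : Fin n → ℤ) → Ineq n → Set
MidpointSatisfies x y = Satisfied (λ i → x i ℤ.+ y i) 2ℤ

MidpointFeasible : System n → (x y : Fin n → ℤ) → Set
MidpointFeasible S x y = All (MidpointSatisfies x y) S

-- Half-spaces are convex: add the two inequalities.
satisfied-midpoint : ∀ (I : Ineq n) {x y} → Satisfied x 1ℤ I → Satisfied y 1ℤ I → MidpointSatisfies x y I
satisfied-midpoint (ineq c d) {x} {y} dx dy = begin
  2ℤ ℤ.* d                                          ≡⟨ double d ⟩
  1ℤ ℤ.* d ℤ.+ 1ℤ ℤ.* d                             ≤⟨ ℤ.+-mono-≤ dx dy ⟩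
  c · x ℤ.+ c · y                                   ≡⟨ ℤΣ.∑-distrib-+ (λ i → c i ℤ.* x i) (λ i → c i ℤ.* y i) ⟨
  ℤΣ.sum (λ i → c i ℤ.* x i ℤ.+ c i ℤ.* y i)        ≡⟨ ℤΣ.sum-cong-≗ (λ i → ℤ.*-distribˡ-+ (c i) (x i) (y i)) ⟨
  c · (λ i → x i ℤ.+ y i)                           ∎
  where
  open ℤ.≤-Reasoning
  double : ∀ d → 2ℤ ℤ.* d ≡ 1ℤ ℤ.* d ℤ.+ 1ℤ ℤ.* d
  double = solve-∀

·-negˡ : (c x : Fin n → ℤ) → (λ i → ℤ.- c i) · x ≡ ℤ.- (c · x)
·-negˡ {zero}  c x = refl
·-negˡ {suc n} c x = begin
  ℤ.- c zero ℤ.* x zero ℤ.+ (λ i → ℤ.- c (suc i)) · (x ∘ suc)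
    ≡⟨ cong₂ ℤ._+_ (sym (ℤ.neg-distribˡ-* (c zero) (x zero))) (·-negˡ (c ∘ suc) (x ∘ suc)) ⟩
  ℤ.- (c zero ℤ.* x zero) ℤ.+ ℤ.- ((c ∘ suc) · (x ∘ suc))
    ≡⟨ ℤ.neg-distrib-+ (c zero ℤ.* x zero) _ ⟨
  ℤ.- (c · x) ∎
  where open ≡-Reasoning

≤⇒satisfied-geq : ∀ {c : Fin n → ℤ} {d x} → d ℤ.≤ c · x → Satisfied x 1ℤ (geq c d)
≤⇒satisfied-geq {d = d} d≤ = subst (ℤ._≤ _) (sym (ℤ.*-identityˡ d)) d≤

≥⇒satisfied-leq : ∀ {c : Fin n → ℤ} {d x} → c · x ℤ.≤ d → Satisfied x 1ℤ (leq c d)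
≥⇒satisfied-leq {c = c} {d} {x} ≤d =
  subst₂ ℤ._≤_ (sym (ℤ.*-identityˡ (ℤ.- d))) (sym (·-negˡ c x)) (ℤ.neg-mono-≤ ≤d)

-- By integrality no integer point falls strictly between `d - 1` and `d`, so each one follows an
-- edge at every node.
≰⇒≤-pred : ∀ {i j} → ¬ j ℤ.≤ i → i ℤ.≤ j ℤ.- 1ℤ
≰⇒≤-pred {i} {j} j≰i = subst (i ℤ.≤_) (ℤ.+-comm ℤ.-1ℤ j) (ℤ.i<j⇒i≤pred[j] (ℤ.≰⇒> j≰i))

AllPairs-All : ∀ {A : Set} {P : A → Set} {R T : A → A → Set} →
               (∀ {x y} → P x → P y → R x y → T x y) →
               ∀ {xs} → All P xs → AllPairs R xs → AllPairs T xs
AllPairs-All f []         []         = []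
AllPairs-All f (px ∷ pxs) (rx ∷ rxs) =
  All.zipWith (λ (py , r) → f px py r) (pxs , rx) ∷ AllPairs-All f pxs rxs

length-filter-split : ∀ {A : Set} {P : A → Set} (P? : Decidable P) xs →
                      length xs ≡ length (filter (¬? ∘ P?) xs) + length (filter P? xs)
length-filter-split P? []       = refl
length-filter-split P? (x ∷ xs) with does (P? x)
... | true  = trans (cong suc (length-filter-split P? xs)) (sym (ℕ.+-suc _ _))
... | false = cong suc (length-filter-split P? xs)

-- Induction on the tree. At a node each integer point goes to the side on which it lies; two points
-- sent to the same side satisfy the new label, hence so does their midpoint, and the invariant
-- passes to the child. At a leaf a feasible midpoint is impossible, so at most one point is left.
length≤2^depth : ∀ {S : System n} (R : Refutation S) (xs : List (Fin n → ℤ)) →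
                 AllPairs (MidpointFeasible S) xs → length xs ≤ 2 ^ depth R
length≤2^depth (leaf _)       []           _                = z≤n
length≤2^depth (leaf _)       (_ ∷ [])     _                = s≤s z≤n
length≤2^depth (leaf contr)   (x ∷ y ∷ xs) ((mid ∷ _) ∷ _)  =
  contradiction contr (feasible⇒¬contradiction _ 2ℤ (ℚ.positive⁻¹ (ℤ→ℚ 2ℤ)) mid)
length≤2^depth {n} {S} (node c d l r) xs feas = begin
  length xs                          ≡⟨ length-filter-split right? xs ⟩
  length xsₗ + length xsᵣ            ≤⟨ ℕ.+-mono-≤ (length≤2^depth l xsₗ feasₗ) (length≤2^depth r xsᵣ feasᵣ) ⟩
  2 ^ depth l + 2 ^ depth r          ≤⟨ ℕ.+-mono-≤ (ℕ.^-monoʳ-≤ 2 (ℕ.m≤m⊔n (depth l) (depth r)))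
                                                   (ℕ.^-monoʳ-≤ 2 (ℕ.m≤n⊔m (depth l) (depth r))) ⟩
  2 ^ D + 2 ^ D                      ≡⟨ cong (λ k → 2 ^ D + k) (ℕ.+-identityʳ (2 ^ D)) ⟨
  2 ^ suc D                          ∎
  where
  open ℕ.≤-Reasoning
  D = depth l ⊔ depth r
  right? : Decidable (λ x → d ℤ.≤ c · x)
  right? x = d ℤ.≤? (c · x)
  xsₗ = filter (¬? ∘ right?) xs
  xsᵣ = filter right? xs
  extend : ∀ {P : (Fin n → ℤ) → Set} {I : Ineq n} {ys} → (∀ {x} → P x → Satisfied x 1ℤ I) →
           All P ys → AllPairs (MidpointFeasible S) ys → AllPairs (MidpointFeasible (I ∷ S)) ys
  extend {I = I} P⇒I = AllPairs-All λ {x} {y} px py feas → satisfied-midpoint I {x} {y} (P⇒I px) (P⇒I py) ∷ feas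
  feasₗ : AllPairs (MidpointFeasible (leq c (d ℤ.- 1ℤ) ∷ S)) xsₗ
  feasₗ = extend (λ {x} d≰ → ≥⇒satisfied-leq {c = c} {x = x} (≰⇒≤-pred d≰))
                 (All.all-filter (¬? ∘ right?) xs) (AllPairs.filter⁺ (¬? ∘ right?) feas)
  feasᵣ : AllPairs (MidpointFeasible (geq c d ∷ S)) xsᵣ
  feasᵣ = extend (λ {x} d≤ → ≤⇒satisfied-geq {c = c} {x = x} d≤)
                 (All.all-filter right? xs) (AllPairs.filter⁺ right? feas)

-- The complete formula

subsets : ∀ n → List (Subset n)
subsets zero    = [ [] ]
subsets (suc n) = map (outside ∷_) (subsets n) ++ map (inside ∷_) (subsets n)

∈-subsets : (u : Subset n) → u ∈ₗ subsets n
∈-subsets []            = here refl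
∈-subsets (outside ∷ u) = ∈-++⁺ˡ (∈-map⁺ (outside ∷_) (∈-subsets u))
∈-subsets (inside ∷ u)  = ∈-++⁺ʳ _ (∈-map⁺ (inside ∷_) (∈-subsets u))

excluding : Subset n → Clause n
excluding u = clause (∁ u) u

completeCNF : ∀ n → CNF n
completeCNF n = map excluding (subsets n)

completeCNF-unsatisfiable : ∀ n → Unsatisfiable (completeCNF n)
completeCNF-unsatisfiable n α sat =
  violates (All.lookup sat (∈-map⁺ excluding (∈-subsets u)))
  where
  -- The falsified clause is the one that excludes `α` itself, read as the set of its true
  -- variables.
  u = Vec.tabulate α
  violates : ¬ SatisfiesClause α (excluding u)
  violates (i , inj₁ (i∈∁u , αi≡true)) =
    x∈∁p⇒x∉p i∈∁u (lookup⇒[]= i u (trans (lookup∘tabulate α i) αi≡true))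
  violates (i , inj₂ (i∈u , αi≡false)) =
    contradiction (trans (sym ([]=⇒lookup i∈u)) (trans (lookup∘tabulate α i) αi≡false)) λ ()

-- Hamming distance and midpoints of 0/1 points

hamming : Subset n → Subset n → ℕ
hamming []            []            = 0
hamming (outside ∷ u) (outside ∷ v) = hamming u v
hamming (outside ∷ u) (inside ∷ v)  = suc (hamming u v)
hamming (inside ∷ u)  (outside ∷ v) = suc (hamming u v)
hamming (inside ∷ u)  (inside ∷ v)  = hamming u v

-- Coordinatewise: where `v` and `w` differ, exactly one of them differs from `u`; where they agree,
-- the right-hand side gains 0 or 2.
hamming-triangle : (u v w : Subset n) → hamming v w ≤ hamming u v + hamming u w
hamming-triangle []            []            []            = z≤n
hamming-triangle (outside ∷ u) (outside ∷ v) (outside ∷ w) = hamming-triangle u v w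
hamming-triangle (outside ∷ u) (outside ∷ v) (inside ∷ w)  =
  ℕ.≤-trans (s≤s (hamming-triangle u v w)) (ℕ.≤-reflexive (sym (ℕ.+-suc _ _)))
hamming-triangle (outside ∷ u) (inside ∷ v)  (outside ∷ w) = s≤s (hamming-triangle u v w)
hamming-triangle (outside ∷ u) (inside ∷ v)  (inside ∷ w)  =
  ℕ.≤-trans (hamming-triangle u v w) (ℕ.+-mono-≤ (ℕ.n≤1+n _) (ℕ.n≤1+n _))
hamming-triangle (inside ∷ u)  (outside ∷ v) (outside ∷ w) =
  ℕ.≤-trans (hamming-triangle u v w) (ℕ.+-mono-≤ (ℕ.n≤1+n _) (ℕ.n≤1+n _))
hamming-triangle (inside ∷ u)  (outside ∷ v) (inside ∷ w)  = s≤s (hamming-triangle u v w)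
hamming-triangle (inside ∷ u)  (inside ∷ v)  (outside ∷ w) =
  ℕ.≤-trans (s≤s (hamming-triangle u v w)) (ℕ.≤-reflexive (sym (ℕ.+-suc _ _)))
hamming-triangle (inside ∷ u)  (inside ∷ v)  (inside ∷ w)  = hamming-triangle u v w

-- A coordinate outside `u` contributes `vᵢ`, one inside contributes `- vᵢ = (1 - vᵢ) - 1`. Against
-- the bound `1 - ∣ u ∣`, the clause inequality thus says that `v` has distance at least 1 from `u`.
excluding-slack : (u v : Subset n) →
                  (λ i → χ (∁ u) i ℤ.- χ u i) · χ v ≡ + hamming u v ℤ.- + ∣ u ∣
excluding-slack []            []            = refl
excluding-slack (outside ∷ u) (outside ∷ v) = trans (ℤ.+-identityˡ _) (excluding-slack u v)
excluding-slack (outside ∷ u) (inside ∷ v)  =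
  trans (cong (λ k → 1ℤ ℤ.+ k) (excluding-slack u v)) (sym (ℤ.+-assoc 1ℤ (+ hamming u v) (ℤ.- + ∣ u ∣)))
excluding-slack (inside ∷ u)  (outside ∷ v) =
  trans (ℤ.+-identityˡ _) (trans (excluding-slack u v) (shift (+ hamming u v) (+ ∣ u ∣)))
  where
  shift : ∀ a b → a ℤ.- b ≡ (1ℤ ℤ.+ a) ℤ.- (1ℤ ℤ.+ b)
  shift = solve-∀
excluding-slack (inside ∷ u)  (inside ∷ v)  =
  trans (cong (λ k → ℤ.-1ℤ ℤ.+ k) (excluding-slack u v)) (shift (+ hamming u v) (+ ∣ u ∣))
  where
  shift : ∀ a b → ℤ.-1ℤ ℤ.+ (a ℤ.- b) ≡ a ℤ.- (1ℤ ℤ.+ b)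
  shift = solve-∀

excluding-midpoint : (u v w : Subset n) → 2 ≤ hamming v w →
                     MidpointSatisfies (χ v) (χ w) (clauseIneq (excluding u))
excluding-midpoint u v w 2≤vw = begin
  2ℤ ℤ.* (1ℤ ℤ.- + ∣ u ∣)
    ≡⟨ double (+ ∣ u ∣) ⟩
  2ℤ ℤ.- (+ ∣ u ∣ ℤ.+ + ∣ u ∣)
    -- The distances from `u` to `v` and `w` sum to at least 2, so they average at least 1 even if
    -- `u` is one of the two points.
    ≤⟨ ℤ.+-monoˡ-≤ (ℤ.- (+ ∣ u ∣ ℤ.+ + ∣ u ∣)) (ℤ.+≤+ (ℕ.≤-trans 2≤vw (hamming-triangle u v w))) ⟩
  (+ hamming u v ℤ.+ + hamming u w) ℤ.- (+ ∣ u ∣ ℤ.+ + ∣ u ∣)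
    ≡⟨ regroup (+ hamming u v) (+ hamming u w) (+ ∣ u ∣) ⟩
  (+ hamming u v ℤ.- + ∣ u ∣) ℤ.+ (+ hamming u w ℤ.- + ∣ u ∣)
    ≡⟨ cong₂ ℤ._+_ (excluding-slack u v) (excluding-slack u w) ⟨
  c · χ v ℤ.+ c · χ w
    ≡⟨ ℤΣ.∑-distrib-+ (λ i → c i ℤ.* χ v i) (λ i → c i ℤ.* χ w i) ⟨
  ℤΣ.sum (λ i → c i ℤ.* χ v i ℤ.+ c i ℤ.* χ w i)
    ≡⟨ ℤΣ.sum-cong-≗ (λ i → ℤ.*-distribˡ-+ (c i) (χ v i) (χ w i)) ⟨
  c · (λ i → χ v i ℤ.+ χ w i) ∎
  where
  open ℤ.≤-Reasoning
  c : Fin _ → ℤ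
  c i = χ (∁ u) i ℤ.- χ u i
  double : ∀ a → 2ℤ ℤ.* (1ℤ ℤ.- a) ≡ 2ℤ ℤ.- (a ℤ.+ a)
  double = solve-∀
  regroup : ∀ a b e → (a ℤ.+ b) ℤ.- (e ℤ.+ e) ≡ (a ℤ.- e) ℤ.+ (b ℤ.- e)
  regroup = solve-∀

-- For `u = ⁅ i ⁆` this evaluates the variable `xᵢ` at `χ v`, and cardinality bounds place it
-- between 0 and 1.
χ·χ≡∣∩∣ : (u v : Subset n) → χ u · χ v ≡ + ∣ u ∩ v ∣
χ·χ≡∣∩∣ []            []            = refl
χ·χ≡∣∩∣ (outside ∷ u) (outside ∷ v) = trans (ℤ.+-identityˡ _) (χ·χ≡∣∩∣ u v)
χ·χ≡∣∩∣ (outside ∷ u) (inside ∷ v)  = trans (ℤ.+-identityˡ _) (χ·χ≡∣∩∣ u v)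
χ·χ≡∣∩∣ (inside ∷ u)  (outside ∷ v) = trans (ℤ.+-identityˡ _) (χ·χ≡∣∩∣ u v)
χ·χ≡∣∩∣ (inside ∷ u)  (inside ∷ v)  = cong (λ k → 1ℤ ℤ.+ k) (χ·χ≡∣∩∣ u v)

-- The bounds `0 ≤ xᵢ ≤ 1` hold at both points and pass to the midpoint by convexity. Only the
-- clauses rely on the distance.
encode-midpoint : (v w : Subset n) → 2 ≤ hamming v w →
                  MidpointFeasible (encode (completeCNF n)) (χ v) (χ w)
encode-midpoint {n} v w 2≤vw =
  All.++⁺ (All.map⁺ (All.universal (λ i →
    satisfied-midpoint (geq (χ ⁅ i ⁆) 0ℤ) {χ v} {χ w} (lower i v) (lower i w)) (allFin n)))
  (All.++⁺ (All.map⁺ (All.universal (λ i →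
    satisfied-midpoint (leq (χ ⁅ i ⁆) 1ℤ) {χ v} {χ w} (upper i v) (upper i w)) (allFin n)))
  (All.map⁺ (All.map⁺ (All.universal (λ u → excluding-midpoint u v w 2≤vw) (subsets n)))))
  where
  lower : ∀ i v → Satisfied (χ v) 1ℤ (geq (χ ⁅ i ⁆) 0ℤ)
  lower i v = ≤⇒satisfied-geq {c = χ ⁅ i ⁆} {x = χ v} 
    (subst (0ℤ ℤ.≤_) (sym (χ·χ≡∣∩∣ ⁅ i ⁆ v)) (ℤ.+≤+ z≤n))
  upper : ∀ i v → Satisfied (χ v) 1ℤ (leq (χ ⁅ i ⁆) 1ℤ)
  upper i v = ≥⇒satisfied-leq {c = χ ⁅ i ⁆} {x = χ v}
    (subst₂ ℤ._≤_ (sym (χ·χ≡∣∩∣ ⁅ i ⁆ v)) (cong +_ (∣⁅x⁆∣≡1 i)) (ℤ.+≤+ (∣p∩q∣≤∣p∣ ⁅ i ⁆ v)))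

-- A code of minimum distance 2

-- Repeating every bit doubles distances; for odd n the last bit is constant.
repetitionCode : ∀ n → List (Subset n)
repetitionCode zero          = [ [] ]
repetitionCode (suc zero)    = [ outside ∷ [] ]
repetitionCode (suc (suc n)) =
     map (λ v → outside ∷ outside ∷ v) (repetitionCode n)
  ++ map (λ v → inside ∷ inside ∷ v) (repetitionCode n)

repetitionCode-length : ∀ n → length (repetitionCode n) ≡ 2 ^ ⌊ n /2⌋
repetitionCode-length zero          = refl
repetitionCode-length (suc zero)    = refl
repetitionCode-length (suc (suc n)) = begin
  length (map 00∷ C ++ map 11∷ C)            ≡⟨ length-++ (map 00∷ C) ⟩
  length (map 00∷ C) + length (map 11∷ C)    ≡⟨ cong₂ _+_ (length-map 00∷ C) (length-map 11∷ C) ⟩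
  length C + length C                        ≡⟨ cong (λ k → length C + k) (ℕ.+-identityʳ (length C)) ⟨
  2 * length C                               ≡⟨ cong (2 *_) (repetitionCode-length n) ⟩
  2 ^ suc ⌊ n /2⌋                            ∎
  where
  open ≡-Reasoning
  C = repetitionCode n
  00∷ 11∷ : Subset n → Subset (2 + n)
  00∷ v = outside ∷ outside ∷ v
  11∷ v = inside ∷ inside ∷ v

repetitionCode-distance : ∀ n → AllPairs (λ v w → 2 ≤ hamming v w) (repetitionCode n)
repetitionCode-distance zero          = [] ∷ []
repetitionCode-distance (suc zero)    = [] ∷ []
repetitionCode-distance (suc (suc n)) =
  AllPairs.++⁺ (AllPairs.map⁺ (repetitionCode-distance n)) (AllPairs.map⁺ (repetitionCode-distance n))
    -- Words from different halves already differ in both leading bits.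
    (All.map⁺ (All.universal (λ v → All.map⁺ (All.universal (λ w → s≤s (s≤s z≤n)) (repetitionCode n)))
      (repetitionCode n)))

-- The depth bound

2^m≤2^n⇒m≤n : ∀ {m n} → 2 ^ m ≤ 2 ^ n → m ≤ n
2^m≤2^n⇒m≤n 2^m≤2^n = ℕ.≮⇒≥ λ n<m → ℕ.<⇒≱ (ℕ.^-monoʳ-< 2 (s≤s (s≤s z≤n)) n<m) 2^m≤2^n

depth≥⌊n/2⌋ : ∀ n (R : SPRefutation (completeCNF n)) → ⌊ n /2⌋ ≤ depth R
depth≥⌊n/2⌋ n R = 2^m≤2^n⇒m≤n (begin
  2 ^ ⌊ n /2⌋                          ≡⟨ repetitionCode-length n ⟨
  length (repetitionCode n)            ≡⟨ length-map χ (repetitionCode n) ⟨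
  length (map χ (repetitionCode n))    ≤⟨ length≤2^depth R _ (AllPairs.map⁺
                                            (AllPairs.map (λ {v} {w} → encode-midpoint v w) (repetitionCode-distance n))) ⟩
  2 ^ depth R                          ∎)
  where open ℕ.≤-Reasoning

-- Raising `n` by 2 raises the right-hand side by 4, so the cases 2 and 3 start the induction. The
-- inequality fails at `n = 1`.
n≤4*⌊n/2⌋ : ∀ {n} → 2 ≤ n → n ≤ 4 * ⌊ n /2⌋
n≤4*⌊n/2⌋ {suc zero}                (s≤s ())
n≤4*⌊n/2⌋ {suc (suc zero)}          _ = s≤s (s≤s z≤n)
n≤4*⌊n/2⌋ {suc (suc (suc zero))}    _ = s≤s (s≤s (s≤s z≤n))
n≤4*⌊n/2⌋ {suc (suc n@(suc (suc _)))} _ = begin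
  2 + n              ≤⟨ ℕ.+-mono-≤ (s≤s (s≤s (z≤n {2}))) (n≤4*⌊n/2⌋ {n} (s≤s (s≤s z≤n))) ⟩
  4 + 4 * ⌊ n /2⌋    ≡⟨ ℕ.*-suc 4 ⌊ n /2⌋ ⟨
  4 * suc ⌊ n /2⌋    ∎
  where open ℕ.≤-Reasoning

theorem1p3 : Σ[ F ∈ ((n : ℕ) → CNF n) ]
    ((∀ n → Unsatisfiable (F n)) ×
    (∃[ C ] ∃[ n₀ ]
    (∀ n → n₀ ≤ n → (R : SPRefutation (F n)) →
    n ≤ C * (⌊log₂ n ⌋ ^ 2 * depth R))))
-- The constant 4 comes from `n≤4*⌊n/2⌋`. The threshold 2 serves that lemma and also ensures
-- `⌊log₂ n ⌋ ≥ 1`.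
theorem1p3 = completeCNF , completeCNF-unsatisfiable , 4 , 2 , bound
  where
  open ℕ.≤-Reasoning
  bound : ∀ n → 2 ≤ n → (R : SPRefutation (completeCNF n)) → n ≤ 4 * (⌊log₂ n ⌋ ^ 2 * depth R)
  bound n 2≤n R = begin
    n                                 ≤⟨ n≤4*⌊n/2⌋ 2≤n ⟩
    4 * ⌊ n /2⌋                       ≤⟨ ℕ.*-monoʳ-≤ 4 (depth≥⌊n/2⌋ n R) ⟩
    4 * depth R                       ≡⟨ cong (4 *_) (ℕ.*-identityˡ (depth R)) ⟨
    -- The linear bound is weakened to the required form: the squared logarithm is at least `1 ^ 2`.
    4 * (1 ^ 2 * depth R)             ≤⟨ ℕ.*-monoʳ-≤ 4 (ℕ.*-monoˡ-≤ (depth R)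
                                           (ℕ.^-monoˡ-≤ 2 (⌊log₂⌋-mono-≤ 2≤n))) ⟩
    4 * (⌊log₂ n ⌋ ^ 2 * depth R)     ∎
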